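{- Let $P$ be an abstract proof system and let $c$ be a pre-proof of $P$. Then $c$ is recursive if and only if $c$ satisfies the global trace condition on every trace structure for $P$.
   Context: Presheaves and polynomials. For a small category $\mathbb{A}$, $\widehat{\mathbb{A}}=\mathbf{Set}^{\mathbb{A}^{\mathrm{op}}}$. For a functor $f\colon\mathbb{I}\to\mathbb{J}$ of small categories, $f^*=(-)\circ f^{\mathrm{op}}\colon\widehat{\mathbb{J}}\to\widehat{\mathbb{I}}$, with left adjoint $f_!$ and right adjoint $f_*$. A discrete fibration is a functor $t\colon\mathbb{E}\to\mathbb{B}$ such that each $b\to t(e)$ has a unique lift $e'\to e$. A two-sided discrete fibration is a pair $(s\colon\mathbb{I}\to\mathbb{A},q\colon\mathbb{I}\to\mathbb{B})$ such that: each $a\to s(i)$ has a unique lift $i'\to i$ which $q$ sends to $\mathrm{id}_{q(i)}$; each $q(i)\to b$ has a unique lift $i\to i'$ which $s$ sends to $\mathrm{id}_{s(i)}$; and for each $f\colon i\to j$ the domain of the lift of $s(f)$ equals the codomain of the lift of $q(f)$ and the composite of these lifts is $f$. A polynomial $(s,q,t)$ is a diagram of small categories $\mathbb{A}\xleftarrow{s}\mathbb{I}\xrightarrow{q}\mathbb{J}\xrightarrow{t}\mathbb{A}$ with $(s,q)$ a two-sided discrete fibration and $t$ a discrete fibration. Its familial functor is $F[P]=t_!q_*s^*\colon\widehat{\mathbb{A}}\to\widehat{\mathbb{A}}$; concretely $F[P](G)(a)\cong\coprod_{j\in\mathbb{J}_a}\lim_{i\in\mathbb{I}_j^{\mathrm{op}}}G(s(i))$,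 where $\mathbb{J}_a$ is the fibre of $t$ over $a$ and $\mathbb{I}_j$ the fibre of $q$ over $j$. A morphism of polynomials $(s',q',t')\to(s,q,t)$ (category $\mathbf{VPoly}$) is a triple of functors $u\colon\mathbb{A}'\to\mathbb{A}$, $u_1\colon\mathbb{I}'\to\mathbb{I}$, $u_2\colon\mathbb{J}'\to\mathbb{J}$ with $us'=su_1$, $u_2q'=qu_1$, $ut'=tu_2$, the last square being a pullback. Proof systems. For $\mathrm{ar}\colon R\to\mathbf{Cat}$ ($\mathbf{Cat}$: small categories), $q_{\mathrm{ar}}\colon\int\mathrm{ar}\to R$ is the Grothendieck opfibration: objects are pairs $(r,i)$ with $i\in\mathrm{ar}(r)$ (also written $i\in\mathrm{ar}(r)$), morphisms $(r,i)\to(r',i')$ are pairs of $h\colon r\to r'$ and $\mathrm{ar}(h)(i)\to i'$. For a presheaf $X$ on a category, $p_X\colon\int X\to\cdot$ denotes its category of elements with projection. An abstract proof system $P=(\mathrm{prem},q_{\mathrm{ar}},\mathrm{ccl})$ consists of small categories $\mathrm{Jdg},R$ and functors $\mathrm{ar}\colon R\to\mathbf{Cat}$, $\mathrm{prem}\colon\int\mathrm{ar}\to\mathrm{Jdg}$, $\mathrm{ccl}\colon R\to\mathrm{Jdg}$ such that $\mathrm{Jdg}\xleftarrow{\mathrm{prem}}\int\mathrm{ar}\xrightarrow{q_{\mathrm{ar}}}R\xrightarrow{\mathrm{ccl}}\mathrm{Jdg}$ is a polynomial; it is used that $\mathrm{prem}(r_1,i)=\mathrm{prem}(r_2,\mathrm{ar}(h)(i))$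 for $h\colon r_1\to r_2$. A pre-proof of $P$ is a coalgebra $c\colon C\to F[P](C)$. It is recursive if for every algebra $a\colon F[P](A)\to A$ there is a unique $h\colon C\to A$ with $h=a\circ F[P](h)\circ c$. The labelled graph of $c$ has nodes $(s,n)$ with $n\in C(s)$, and, when $c_s(n)=(r,\langle n_i\rangle_{i\in\mathrm{ar}(r)^{\mathrm{op}}})$, an edge from $n\in C(s)$ to $n_i\in C(\mathrm{prem}(r,i))$ labelled $i\in\mathrm{ar}(r)$ for each $i\in\mathrm{ar}(r)$. Trace structures. A trace structure for $P$ consists of: a presheaf $\mathrm{fml}\in\widehat{\mathrm{Jdg}}$; a proof system $T=(\int\mathrm{fml}\xleftarrow{\mathrm{prem}'}\int\mathrm{ar}'\xrightarrow{q_{\mathrm{ar}'}}R'\xrightarrow{\mathrm{ccl}'}\int\mathrm{fml})$ and a morphism $T\to P$ in $\mathbf{VPoly}$ whose component on judgements is the projection $p_{\mathrm{fml}}\colon\int\mathrm{fml}\to\mathrm{Jdg}$; and a set $\mathrm{prog}$ as follows. For $i\in\mathrm{ar}(r)$, $\varphi\in\mathrm{fml}(\mathrm{ccl}(r))$, $\psi\in\mathrm{fml}(\mathrm{prem}(r,i))$ write $\varphi\stackrel{i\in\mathrm{ar}(r)}{\rightsquigarrow}\psi$ if there is $i'\in\int\mathrm{ar}'$ with $(p_{\mathrm{fml}})_1(i')=(r,i)$, $\mathrm{prem}'(i')=\psi$ and $\mathrm{ccl}'(q_{\mathrm{ar}'}(i'))=\varphi$. Then $\mathrm{prog}$ is a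 subset of the set of all such steps $\varphi\stackrel{i\in\mathrm{ar}(r)}{\rightsquigarrow}\psi$ (ranging over all $(r,i)\in\int\mathrm{ar}$; elements are called progressing), and it is required that for each $h\colon r_1\to r_2$ in $R$ and $i\in\mathrm{ar}(r_1)$, $\varphi\stackrel{\mathrm{ar}(h)(i)\in\mathrm{ar}(r_2)}{\rightsquigarrow}\psi$ (resp. and it is in $\mathrm{prog}$) implies $\mathrm{fml}(\mathrm{ccl}(h))(\varphi)\stackrel{i\in\mathrm{ar}(r_1)}{\rightsquigarrow}\psi$ (resp. and it is in $\mathrm{prog}$). A trace along an infinite path $\langle n_k\in C(s_k)\rangle_{k\in\mathbb{N}}$ with labels $\langle j_k\in\mathrm{ar}(r_k)\rangle_{k\in\mathbb{N}}$ in the labelled graph of $c$ is a sequence $\varphi_k\in\mathrm{fml}(s_k)$ with $\varphi_k\stackrel{j_k\in\mathrm{ar}(r_k)}{\rightsquigarrow}\varphi_{k+1}$ for all $k$; it is infinitely progressing if infinitely many of these steps are in $\mathrm{prog}$. The pre-proof $c$ satisfies the global trace condition (GTC) on the trace structure if for every infinite path in the labelled graph of $c$ there is an infinitely progressing trace along some suffix of it. -}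

module Defs where

open import Level using (Level; _⊔_; suc)
open import Axiom.Extensionality.Propositional using (Extensionality; implicit-extensionality)
open import Axiom.UniquenessOfIdentityProofs.WithK using (uip)
open import Data.Nat.Base using (ℕ; _+_; _≤_) renaming (suc to 1+_)
open import Data.Product using (Σ; ∃!; Σ-syntax; ∃-syntax; _×_; _,_; proj₁; proj₂)
open import Relation.Binary.PropositionalEquality
  using (_≡_; refl; sym; trans; cong; cong-app; subst; module ≡-Reasoning)

-- Categories are strict: objects and morphisms are compared with _≡_.  Axiom K
-- is on, so every type is a set in the sense that _≡_ is proof irrelevant.

record Category (o h : Level) : Set (suc (o ⊔ h)) where
  infixr 9 _∘_
  field
    Obj       : Set o
    Hom       : Obj → Obj → Set h
    id        : ∀ {x} → Hom x x
    _∘_       : ∀ {x y z} → Hom y z → Hom x y → Hom x z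
    identityˡ : ∀ {x y} (f : Hom x y) → id ∘ f ≡ f
    identityʳ : ∀ {x y} (f : Hom x y) → f ∘ id ≡ f
    assoc     : ∀ {w x y z} (f : Hom y z) (g : Hom x y) (h : Hom w x) →
                (f ∘ g) ∘ h ≡ f ∘ (g ∘ h)

  Into : Obj → Set (o ⊔ h)
  Into x = ∃[ w ] Hom w x

  OutOf : Obj → Set (o ⊔ h)
  OutOf x = ∃[ y ] Hom x y

  hom≡ : ∀ {x y} → x ≡ y → Hom x y
  hom≡ refl = id

  hom≡-unique : ∀ {x y} (p q : x ≡ y) → hom≡ p ≡ hom≡ q
  hom≡-unique p q = cong hom≡ (uip p q)

  hom≡-trans : ∀ {x y z} (p : x ≡ y) (q : y ≡ z) → hom≡ q ∘ hom≡ p ≡ hom≡ (trans p q)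
  hom≡-trans refl q = identityʳ (hom≡ q)

open Category public using (Obj; Hom; Into; OutOf)

_ᵒᵖ : ∀ {o h} → Category o h → Category o h
C ᵒᵖ = record
  { Obj = C.Obj
  ; Hom = λ x y → C.Hom y x
  ; id = C.id
  ; _∘_ = λ f g → g C.∘ f
  ; identityˡ = C.identityʳ
  ; identityʳ = C.identityˡ
  ; assoc = λ f g h → sym (C.assoc h g f)
  }
  where module C = Category C

Sets : ∀ ℓ → Category (suc ℓ) ℓ
Sets ℓ = record
  { Obj = Set ℓ
  ; Hom = λ A B → A → B
  ; id = λ x → x
  ; _∘_ = λ f g x → f (g x)
  ; identityˡ = λ _ → refl
  ; identityʳ = λ _ → refl
  ; assoc = λ _ _ _ → refl
  }

record Functor {o h o′ h′} (C : Category o h) (D : Category o′ h′) :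
               Set (o ⊔ h ⊔ o′ ⊔ h′) where
  private
    module C = Category C
    module D = Category D
  field
    F₀           : C.Obj → D.Obj
    F₁           : ∀ {x y} → C.Hom x y → D.Hom (F₀ x) (F₀ y)
    identity     : ∀ x → F₁ (C.id {x}) ≡ D.id
    homomorphism : ∀ {x y z} (g : C.Hom y z) (f : C.Hom x y) →
                   F₁ (g C.∘ f) ≡ F₁ g D.∘ F₁ f

  mapInto : ∀ {x} → C.Into x → D.Into (F₀ x)
  mapInto (w , f) = F₀ w , F₁ f

  mapOutOf : ∀ {x} → C.OutOf x → D.OutOf (F₀ x)
  mapOutOf (y , f) = F₀ y , F₁ f

  F₁-hom≡ : ∀ {x y} (p : x ≡ y) → F₁ (C.hom≡ p) ≡ D.hom≡ (cong F₀ p)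
  F₁-hom≡ {x} refl = identity x

open Functor public using (F₀; F₁; mapInto; mapOutOf)

idF : ∀ {o h} {C : Category o h} → Functor C C
idF = record
  { F₀ = λ x → x ; F₁ = λ f → f ; identity = λ _ → refl ; homomorphism = λ _ _ → refl }

infixr 9 _∘F_

_∘F_ : ∀ {o h o′ h′ o″ h″}
         {C : Category o h} {D : Category o′ h′} {E : Category o″ h″} →
       Functor D E → Functor C D → Functor C E
G ∘F F = record
  { F₀ = λ x → G.F₀ (F.F₀ x)
  ; F₁ = λ f → G.F₁ (F.F₁ f)
  ; identity = λ x → trans (cong G.F₁ (F.identity x)) (G.identity (F.F₀ x))
  ; homomorphism = λ g f →
      trans (cong G.F₁ (F.homomorphism g f)) (G.homomorphism (F.F₁ g) (F.F₁ f))
  }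
  where
  module F = Functor F
  module G = Functor G

opF : ∀ {o h o′ h′} {C : Category o h} {D : Category o′ h′} →
      Functor C D → Functor (C ᵒᵖ) (D ᵒᵖ)
opF F = record
  { F₀ = F.F₀ ; F₁ = F.F₁ ; identity = F.identity
  ; homomorphism = λ g f → F.homomorphism f g }
  where module F = Functor F

record NatTrans {o h o′ h′} {C : Category o h} {D : Category o′ h′}
                (F G : Functor C D) : Set (o ⊔ h ⊔ h′) where
  private
    module D = Category D
  field
    η       : ∀ x → Hom D (F₀ F x) (F₀ G x)
    natural : ∀ {x y} (f : Hom C x y) → F₁ G f D.∘ η x ≡ η y D.∘ F₁ F f

open NatTrans public using (η)

record IsPullback {o h} (𝒞 : Category o h) {X Y Z W : Obj 𝒞}
                  (p₁ : Hom 𝒞 W X) (p₂ : Hom 𝒞 W Y)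
                  (f : Hom 𝒞 X Z) (g : Hom 𝒞 Y Z) : Set (o ⊔ h) where
  open Category 𝒞 using (_∘_)
  field
    commutes  : f ∘ p₁ ≡ g ∘ p₂
    universal : ∀ {Q} (q₁ : Hom 𝒞 Q X) (q₂ : Hom 𝒞 Q Y) → f ∘ q₁ ≡ g ∘ q₂ →
                ∃! _≡_ λ (k : Hom 𝒞 Q W) → p₁ ∘ k ≡ q₁ × p₂ ∘ k ≡ q₂

module _ {o h} {𝒞 : Category o h} (F : Functor 𝒞 𝒞) where
  open Category 𝒞 using (_∘_)

  Coalgebra : Obj 𝒞 → Set h
  Coalgebra C = Hom 𝒞 C (F₀ F C)

  Algebra : Obj 𝒞 → Set h
  Algebra A = Hom 𝒞 (F₀ F A) A

  Recursive : ∀ {C} → Coalgebra C → Set (o ⊔ h)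
  Recursive {C} c = ∀ {A} (a : Algebra A) →
    ∃! _≡_ λ (k : Hom 𝒞 C A) → k ≡ a ∘ F₁ F k ∘ c

-- `Into 𝔹 x` is the set of pairs of an object w and a morphism w → x, so an
-- equation in it says both that the domains agree and that the morphisms do.

module _ {ℓ} {𝔼 𝔹 : Category ℓ ℓ} where

  IsDiscreteFibration : Functor 𝔼 𝔹 → Set ℓ
  IsDiscreteFibration t =
    ∀ e (f : Into 𝔹 (F₀ t e)) → ∃! _≡_ λ (g : Into 𝔼 e) → mapInto t g ≡ f

  Fibre : Functor 𝔼 𝔹 → Obj 𝔹 → Set ℓ
  Fibre t b = ∃[ e ] F₀ t e ≡ b

record IsTwoSidedDiscreteFibration {ℓ} {𝕀 𝔸 𝔹 : Category ℓ ℓ}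
         (s : Functor 𝕀 𝔸) (q : Functor 𝕀 𝔹) : Set ℓ where
  private
    module 𝕀 = Category 𝕀
    module 𝔸 = Category 𝔸
    module 𝔹 = Category 𝔹
  field
    s-lift : ∀ i (f : Into 𝔸 (F₀ s i)) →
             ∃! _≡_ λ (g : Into 𝕀 i) → mapInto s g ≡ f × mapInto q g ≡ (F₀ q i , 𝔹.id)
    q-lift : ∀ i (f : OutOf 𝔹 (F₀ q i)) →
             ∃! _≡_ λ (g : OutOf 𝕀 i) → mapOutOf q g ≡ f × mapOutOf s g ≡ (F₀ s i , 𝔸.id)

  lift-of-s : ∀ {i j} → Hom 𝕀 i j → Into 𝕀 j
  lift-of-s {i} {j} f = proj₁ (s-lift j (F₀ s i , F₁ s f))

  lift-of-q : ∀ {i j} → Hom 𝕀 i j → OutOf 𝕀 i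
  lift-of-q {i} {j} f = proj₁ (q-lift i (F₀ q j , F₁ q f))

  field
    factorisation : ∀ {i j} (f : Hom 𝕀 i j) →
      Σ[ e ∈ proj₁ (lift-of-q f) ≡ proj₁ (lift-of-s f) ]
        proj₂ (lift-of-s f) 𝕀.∘ subst (𝕀.Hom i) e (proj₂ (lift-of-q f)) ≡ f

record Polynomial {ℓ} (𝔸 : Category ℓ ℓ) : Set (suc ℓ) where
  field
    {𝕀 𝕁}       : Category ℓ ℓ
    s           : Functor 𝕀 𝔸
    q           : Functor 𝕀 𝕁
    t           : Functor 𝕁 𝔸
    sq-twoSided : IsTwoSidedDiscreteFibration s q
    t-discrete  : IsDiscreteFibration t

Presheaf : ∀ {ℓ} → Category ℓ ℓ → Set (suc ℓ)
Presheaf {ℓ} 𝔸 = Functor (𝔸 ᵒᵖ) (Sets ℓ)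

module _ {ℓ} {𝔸 : Category ℓ ℓ} (X : Presheaf 𝔸) where
  private
    module 𝔸 = Category 𝔸
    module X = Functor X

    elements-≡ : ∀ {a b} {x : X.F₀ a} {y : X.F₀ b}
                 {f g : Σ[ f ∈ 𝔸.Hom a b ] X.F₁ f y ≡ x} → proj₁ f ≡ proj₁ g → f ≡ g
    elements-≡ {f = f , p} {g = .f , q} refl = cong (f ,_) (uip p q)

  ∫ : Category ℓ ℓ
  ∫ = record
    { Obj = Σ 𝔸.Obj X.F₀
    ; Hom = λ (a , x) (b , y) → Σ[ f ∈ 𝔸.Hom a b ] X.F₁ f y ≡ x
    ; id = λ {(a , x)} → 𝔸.id , cong-app (X.identity a) x
    ; _∘_ = λ {_} {_} {(_ , z)} (g , q) (f , p) →
        (g 𝔸.∘ f) , trans (cong-app (X.homomorphism f g) z) (trans (cong (X.F₁ f) q) p)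
    ; identityˡ = λ (f , _) → elements-≡ (𝔸.identityˡ f)
    ; identityʳ = λ (f , _) → elements-≡ (𝔸.identityʳ f)
    ; assoc = λ (f , _) (g , _) (h , _) → elements-≡ (𝔸.assoc f g h)
    }

  projection : Functor ∫ 𝔸
  projection = record
    { F₀ = proj₁ ; F₁ = proj₁ ; identity = λ _ → refl ; homomorphism = λ _ _ → refl }

-- Extensionality makes _≡_ the right equality for functors, natural transformations
-- and compatible families; without it Cat and [ C , D ] would not be categories.

module Extensional {ℓ} (fe : Extensionality ℓ ℓ) where

  private
    ife = implicit-extensionality fe

  module _ {o} {C : Category ℓ ℓ} {D : Category o ℓ} where
    private
      module D = Category D

    functor-≡ : {F G : Functor C D} →
                _≡_ {A = Σ[ F₀ ∈ (Obj C → Obj D) ] (∀ {x y} → Hom C x y → Hom D (F₀ x) (F₀ y))}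
                    (F₀ F , F₁ F) (F₀ G , F₁ G) →
                F ≡ G
    functor-≡ {record { F₀ = F₀ ; F₁ = F₁ ; identity = i ; homomorphism = m }}
              {record { identity = i′ ; homomorphism = m′ }} refl =
      cong-fields (fe λ x → uip (i x) (i′ x))
                  (ife λ {x} → ife λ {y} → ife λ {z} → fe λ g → fe λ f → uip (m g f) (m′ g f))
      where
      module C = Category C
      cong-fields : {i i′ : ∀ x → F₁ (C.id {x}) ≡ D.id}
                    {m m′ : ∀ {x y z} (g : C.Hom y z) (f : C.Hom x y) →
                            F₁ (g C.∘ f) ≡ F₁ g D.∘ F₁ f} →
                    i ≡ i′ → (λ {x} {y} {z} → m {x} {y} {z}) ≡ m′ →
                    _≡_ {A = Functor C D}
                        (record { F₀ = F₀ ; F₁ = F₁ ; identity = i ; homomorphism = m })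
                        (record { F₀ = F₀ ; F₁ = F₁ ; identity = i′ ; homomorphism = m′ })
      cong-fields refl refl = refl

    natTrans-≡ : {F G : Functor C D} {α β : NatTrans F G} → (∀ x → η α x ≡ η β x) → α ≡ β
    natTrans-≡ {F} {G} {α} {β} eq = go (fe eq)
      where
      go : {α β : NatTrans F G} → η α ≡ η β → α ≡ β
      go {record { η = e ; natural = n }} {record { natural = n′ }} refl =
        cong-natural (ife λ {x} → ife λ {y} → fe λ f → uip (n f) (n′ f))
        where
        cong-natural : {n n′ : ∀ {x y} (f : Hom C x y) → F₁ G f D.∘ e x ≡ e y D.∘ F₁ F f} →
                       (λ {x} {y} → n {x} {y}) ≡ n′ →
                       _≡_ {A = NatTrans F G} (record { η = e ; natural = n })
                                              (record { η = e ; natural = n′ })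
        cong-natural refl = refl

  Cat : Category (suc ℓ) ℓ
  Cat = record
    { Obj = Category ℓ ℓ
    ; Hom = Functor
    ; id = idF
    ; _∘_ = _∘F_
    ; identityˡ = λ _ → functor-≡ refl
    ; identityʳ = λ _ → functor-≡ refl
    ; assoc = λ _ _ _ → functor-≡ refl
    }

  [_,_] : ∀ {o} → Category ℓ ℓ → Category o ℓ → Category (o ⊔ ℓ) ℓ
  [ C , D ] = record
    { Obj = Functor C D
    ; Hom = NatTrans
    ; id = λ {F} → record
        { η = λ _ → D.id
        ; natural = λ f → trans (D.identityʳ (F₁ F f)) (sym (D.identityˡ (F₁ F f))) }
    ; _∘_ = λ {F} {G} {H} β α → record
        { η = λ x → η β x D.∘ η α x
        ; natural = λ {x} {y} f → begin
            F₁ H f D.∘ (η β x D.∘ η α x)   ≡⟨ D.assoc _ _ _ ⟨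
            (F₁ H f D.∘ η β x) D.∘ η α x   ≡⟨ cong (D._∘ η α x) (NatTrans.natural β f) ⟩
            (η β y D.∘ F₁ G f) D.∘ η α x   ≡⟨ D.assoc _ _ _ ⟩
            η β y D.∘ (F₁ G f D.∘ η α x)   ≡⟨ cong (η β y D.∘_) (NatTrans.natural α f) ⟩
            η β y D.∘ (η α y D.∘ F₁ F f)   ≡⟨ D.assoc _ _ _ ⟨
            (η β y D.∘ η α y) D.∘ F₁ F f   ∎ }
    ; identityˡ = λ α → natTrans-≡ λ x → D.identityˡ (η α x)
    ; identityʳ = λ α → natTrans-≡ λ x → D.identityʳ (η α x)
    ; assoc = λ α β γ → natTrans-≡ λ x → D.assoc (η α x) (η β x) (η γ x)
    }
    where
    module D = Category D
    open ≡-Reasoning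

  Psh : Category ℓ ℓ → Category (suc ℓ) ℓ
  Psh 𝔸 = [ 𝔸 ᵒᵖ , Sets ℓ ]

  restrict : {𝕀 𝕁 : Category ℓ ℓ} → Functor 𝕀 𝕁 → Functor (Psh 𝕁) (Psh 𝕀)
  restrict f = record
    { F₀ = λ X → X ∘F opF f
    ; F₁ = λ α → record { η = λ i → η α (F₀ f i) ; natural = λ u → NatTrans.natural α (F₁ f u) }
    ; identity = λ _ → natTrans-≡ λ _ → refl
    ; homomorphism = λ _ _ → natTrans-≡ λ _ → refl
    }

  module _ {𝕀 𝕁 : Category ℓ ℓ} (q : Functor 𝕀 𝕁) where
    private
      module 𝕀 = Category 𝕀
      module 𝕁 = Category 𝕁
      module q = Functor q

    -- The limit of X over the opposite of the comma category (q ↓ j): the value at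
    -- j of the right adjoint of restriction along q.  When q is an opfibration, a
    -- family is determined by its components at the (i , id) with i in the fibre
    -- over j, so that this is the limit of X over the opposite of the fibre.
    record Family (X : Presheaf 𝕀) (j : Obj 𝕁) : Set ℓ where
      constructor family
      field
        component  : ∀ i → 𝕁.Hom (q.F₀ i) j → F₀ X i
        compatible : ∀ {i i′} (w : 𝕀.Hom i i′) (v : 𝕁.Hom (q.F₀ i′) j) →
                     F₁ X w (component i′ v) ≡ component i (v 𝕁.∘ q.F₁ w)

    open Family public

    family-≡ : ∀ {X j} {x y : Family X j} →
               (∀ i v → component x i v ≡ component y i v) → x ≡ y
    family-≡ {X} {j} {family x c} {family y d} eq = go (fe λ i → fe λ v → eq i v)
      where
      go : ∀ {y} {d : ∀ {i i′} w v → F₁ X w (y i′ v) ≡ y i (v 𝕁.∘ q.F₁ w)} →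
           x ≡ y → family {X} {j} x c ≡ family y (λ {i} {i′} → d {i} {i′})
      go {d = d} refl = go′ (ife λ {i} → ife λ {i′} → fe λ w → fe λ v → uip (c w v) (d w v))
        where
        go′ : {c d : ∀ {i i′} w v → F₁ X w (x i′ v) ≡ x i (v 𝕁.∘ q.F₁ w)} →
              (λ {i} {i′} → c {i} {i′}) ≡ d →
              family {X} {j} x (λ {i} {i′} → c {i} {i′}) ≡ family x (λ {i} {i′} → d {i} {i′})
        go′ refl = refl

    rightKan : Functor (Psh 𝕀) (Psh 𝕁)
    rightKan = record
      { F₀ = λ X → record
          { F₀ = Family X
          ; F₁ = λ g x → family
              (λ i v → component x i (g 𝕁.∘ v))
              (λ w v → trans (compatible x w (g 𝕁.∘ v))
                             (cong (component x _) (𝕁.assoc g v (q.F₁ w))))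
          ; identity = λ j → fe λ x → family-≡ λ i v →
              cong (component x i) (𝕁.identityˡ v)
          ; homomorphism = λ g f → fe λ x → family-≡ λ i v →
              cong (component x i) (𝕁.assoc f g v)
          }
      ; F₁ = λ α → record
          { η = λ j x → family
              (λ i v → η α i (component x i v))
              (λ {i} {i′} w v → trans (cong-app (NatTrans.natural α w) (component x i′ v))
                                      (cong (η α i) (compatible x w v)))
          ; natural = λ g → fe λ x → family-≡ λ _ _ → refl
          }
      ; identity = λ X → natTrans-≡ λ j → fe λ x → family-≡ λ _ _ → refl
      ; homomorphism = λ β α → natTrans-≡ λ j → fe λ x → family-≡ λ _ _ → refl
      }

  module _ {𝕁 𝔸 : Category ℓ ℓ} (t : Functor 𝕁 𝔸) (t-discrete : IsDiscreteFibration t) where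
    private
      module 𝕁 = Category 𝕁
      module 𝔸 = Category 𝔸
      module t = Functor t

    Total : Presheaf 𝕁 → Obj 𝔸 → Set ℓ
    Total X a = Σ[ j ∈ Fibre t a ] F₀ X (proj₁ j)

    transport : ∀ X {a b} → 𝔸.Hom b a → Total X a → Total X b
    transport X {b = b} f ((j , refl) , x) with t-discrete j (b , f)
    ... | (j′ , g) , lifts , _ = (j′ , cong proj₁ lifts) , F₁ X g x

    transport-lift : ∀ X {j j′} (g : 𝕁.Hom j′ j) (x : F₀ X j) →
                     transport X (t.F₁ g) ((j , refl) , x) ≡ ((j′ , refl) , F₁ X g x)
    transport-lift X {j} {j′} g x with t-discrete j (t.F₀ j′ , t.F₁ g)
    ... | (_ , _) , lifts , unique with unique {j′ , g} refl
    ... | refl = cong (λ e → (j′ , e) , F₁ X g x) (uip (cong proj₁ lifts) refl)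

    transport-id : ∀ X {a} (z : Total X a) → transport X 𝔸.id z ≡ z
    transport-id X ((j , refl) , x) = begin
      transport X 𝔸.id ((j , refl) , x)
        ≡⟨ cong (λ f → transport X f ((j , refl) , x)) (t.identity j) ⟨
      transport X (t.F₁ 𝕁.id) ((j , refl) , x)
        ≡⟨ transport-lift X 𝕁.id x ⟩
      ((j , refl) , F₁ X 𝕁.id x)
        ≡⟨ cong ((j , refl) ,_) (cong-app (Functor.identity X j) x) ⟩
      ((j , refl) , x) ∎
      where open ≡-Reasoning

    transport-∘ : ∀ X {a b c} (f : 𝔸.Hom b a) (g : 𝔸.Hom c b) (z : Total X a) →
                  transport X (f 𝔸.∘ g) z ≡ transport X g (transport X f z)
    transport-∘ X {b = b} {c} f g ((j , refl) , x) with t-discrete j (b , f)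
    ... | (j′ , f′) , refl , _ with t-discrete j′ (c , g)
    ... | (j″ , g′) , refl , _ = begin
      transport X (t.F₁ f′ 𝔸.∘ t.F₁ g′) ((j , refl) , x)
        ≡⟨ cong (λ k → transport X k ((j , refl) , x)) (t.homomorphism f′ g′) ⟨
      transport X (t.F₁ (f′ 𝕁.∘ g′)) ((j , refl) , x)
        ≡⟨ transport-lift X (f′ 𝕁.∘ g′) x ⟩
      ((j″ , refl) , F₁ X (f′ 𝕁.∘ g′) x)
        ≡⟨ cong ((j″ , refl) ,_) (cong-app (Functor.homomorphism X g′ f′) x) ⟩
      ((j″ , refl) , F₁ X g′ (F₁ X f′ x)) ∎
      where open ≡-Reasoning

    transport-natural : ∀ {X Y} (α : NatTrans X Y) {a b} (f : 𝔸.Hom b a) (z : Total X a) →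
      transport Y f (proj₁ z , η α _ (proj₂ z)) ≡
      (proj₁ (transport X f z) , η α _ (proj₂ (transport X f z)))
    transport-natural α {b = b} f ((j , refl) , x) with t-discrete j (b , f)
    ... | (j′ , g) , lifts , _ = cong ((j′ , cong proj₁ lifts) ,_)
                                      (cong-app (NatTrans.natural α g) x)

    -- For a discrete fibration t, the left adjoint of restriction along t is given
    -- by coproducts over its fibres.
    leftKan : Functor (Psh 𝕁) (Psh 𝔸)
    leftKan = record
      { F₀ = λ X → record
          { F₀ = Total X
          ; F₁ = transport X
          ; identity = λ a → fe (transport-id X)
          ; homomorphism = λ g f → fe (transport-∘ X f g)
          }
      ; F₁ = λ α → record
          { η = λ a (j , x) → j , η α (proj₁ j) x
          ; natural = λ f → fe (transport-natural α f)
          }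
      ; identity = λ X → natTrans-≡ λ a → refl
      ; homomorphism = λ β α → natTrans-≡ λ a → refl
      }

  F[_] : {𝔸 : Category ℓ ℓ} → Polynomial 𝔸 → Functor (Psh 𝔸) (Psh 𝔸)
  F[ P ] = leftKan t t-discrete ∘F rightKan q ∘F restrict s
    where open Polynomial P

  -- A morphism of polynomials whose component on the outer categories is u.
  record PolynomialMorphism {𝔸′ 𝔸 : Category ℓ ℓ} (u : Functor 𝔸′ 𝔸)
                            (P′ : Polynomial 𝔸′) (P : Polynomial 𝔸) : Set (suc ℓ) where
    private
      module P′ = Polynomial P′
      module P = Polynomial P
    field
      u₁       : Functor P′.𝕀 P.𝕀
      u₂       : Functor P′.𝕁 P.𝕁
      s-square : u ∘F P′.s ≡ P.s ∘F u₁
      q-square : u₂ ∘F P′.q ≡ P.q ∘F u₁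
      t-square : IsPullback Cat P′.t u₂ u P.t

  module _ {R : Category ℓ ℓ} (ar : Functor R Cat) where
    private
      module R = Category R
      module ar = Functor ar
      module Ar r = Category (ar.F₀ r)

      at : ∀ {r r′} {F G : Functor (ar.F₀ r) (ar.F₀ r′)} → F ≡ G → ∀ i → F₀ F i ≡ F₀ G i
      at e i = cong (λ F → F₀ F i) e

    reindex : ∀ {r r′} → R.Hom r r′ → Obj (ar.F₀ r) → Obj (ar.F₀ r′)
    reindex h = F₀ (ar.F₁ h)

    private
      GObj : Set ℓ
      GObj = Σ[ r ∈ R.Obj ] Obj (ar.F₀ r)

      GHom : GObj → GObj → Set ℓ
      GHom (r , i) (r′ , i′) = Σ[ h ∈ R.Hom r r′ ] Hom (ar.F₀ r′) (reindex h i) i′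

      gid : ∀ {x} → GHom x x
      gid {r , i} = R.id , Ar.hom≡ r (at (ar.identity r) i)

      infixr 9 _∙_
      _∙_ : ∀ {x y z} → GHom y z → GHom x y → GHom x z
      _∙_ {r , i} {r′ , i′} {r″ , i″} (g , l) (f , k) =
        (g R.∘ f) , l ∘ (F₁ (ar.F₁ g) k ∘ hom≡ (at (ar.homomorphism g f) i))
        where open Category (ar.F₀ r″)

      hom-≡ : ∀ {r i r′ i′} {f g : R.Hom r r′}
              {k : Hom (ar.F₀ r′) (reindex f i) i′} {l : Hom (ar.F₀ r′) (reindex g i) i′}
              (e : f ≡ g) → k ≡ Category._∘_ (ar.F₀ r′) l
                                  (Ar.hom≡ r′ (cong (λ h → reindex h i) e)) →
              _≡_ {A = GHom (r , i) (r′ , i′)} (f , k) (g , l)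
      hom-≡ {r′ = r′} {f = f} refl e = cong (f ,_) (trans e (Ar.identityʳ r′ _))

      slide : ∀ {r r′} {F G : Functor (ar.F₀ r) (ar.F₀ r′)} (e : F ≡ G)
              {x y} (k : Hom (ar.F₀ r) x y) →
              Category._∘_ (ar.F₀ r′) (Ar.hom≡ r′ (at e y)) (F₁ F k) ≡
              Category._∘_ (ar.F₀ r′) (F₁ G k) (Ar.hom≡ r′ (at e x))
      slide {r′ = r′} {F} refl k =
        trans (Ar.identityˡ r′ (F₁ F k)) (sym (Ar.identityʳ r′ (F₁ F k)))

      ∙-identityˡ : ∀ {x y} (f : GHom x y) → gid ∙ f ≡ f
      ∙-identityˡ {r , i} {r′ , i′} (f , k) = hom-≡ (R.identityˡ f) (begin
        hom≡ (at eI i′) ∘ (F₁ (ar.F₁ R.id) k ∘ hom≡ eM)   ≡⟨ assoc _ _ _ ⟨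
        (hom≡ (at eI i′) ∘ F₁ (ar.F₁ R.id) k) ∘ hom≡ eM   ≡⟨ cong (_∘ hom≡ eM) (slide eI k) ⟩
        (k ∘ hom≡ (at eI _)) ∘ hom≡ eM                    ≡⟨ assoc _ _ _ ⟩
        k ∘ (hom≡ (at eI _) ∘ hom≡ eM)                    ≡⟨ cong (k ∘_) (hom≡-trans eM _) ⟩
        k ∘ hom≡ (trans eM (at eI _))                     ≡⟨ cong (k ∘_) (hom≡-unique (trans eM (at eI _)) eR) ⟩
        k ∘ hom≡ eR                                       ∎)
        where
        open Category (ar.F₀ r′)
        open ≡-Reasoning
        eI = ar.identity r′
        eM = at (ar.homomorphism R.id f) i
        eR = cong (λ h → reindex h i) (R.identityˡ f)

      ∙-identityʳ : ∀ {x y} (f : GHom x y) → f ∙ gid ≡ f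
      ∙-identityʳ {r , i} {r′ , i′} (f , k) = hom-≡ (R.identityʳ f) (cong (k ∘_) (begin
        F₁ (ar.F₁ f) (Ar.hom≡ r eI) ∘ hom≡ eM   ≡⟨ cong (_∘ hom≡ eM) (Functor.F₁-hom≡ (ar.F₁ f) eI) ⟩
        hom≡ (cong (reindex f) eI) ∘ hom≡ eM    ≡⟨ hom≡-trans eM _ ⟩
        hom≡ (trans eM (cong (reindex f) eI))   ≡⟨ hom≡-unique (trans eM (cong (reindex f) eI)) eR ⟩
        hom≡ eR                                 ∎))
        where
        open Category (ar.F₀ r′)
        open ≡-Reasoning
        eI = at (ar.identity r) i
        eM = at (ar.homomorphism f R.id) i
        eR = cong (λ h → reindex h i) (R.identityʳ f)

      ∙-assoc : ∀ {w x y z} (f : GHom y z) (g : GHom x y) (h : GHom w x) →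
                (f ∙ g) ∙ h ≡ f ∙ (g ∙ h)
      ∙-assoc {r₀ , i₀} {r₁ , i₁} {r₂ , i₂} {r₃ , i₃} (f , k) (g , l) (h , m) =
        hom-≡ (R.assoc f g h) (begin
          (k ∘ (Ff l ∘ hom≡ e₁)) ∘ (Ffg m ∘ hom≡ e₂)
            ≡⟨ assoc _ _ _ ⟩
          k ∘ ((Ff l ∘ hom≡ e₁) ∘ (Ffg m ∘ hom≡ e₂))
            ≡⟨ cong (k ∘_) inner ⟩
          k ∘ (Ff (l ∘₂ (Fg m ∘₂ Ar.hom≡ r₂ e₃)) ∘ (hom≡ e₄ ∘ hom≡ e₅))
            ≡⟨ cong (k ∘_) (assoc _ _ _) ⟨
          k ∘ ((Ff (l ∘₂ (Fg m ∘₂ Ar.hom≡ r₂ e₃)) ∘ hom≡ e₄) ∘ hom≡ e₅)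
            ≡⟨ assoc _ _ _ ⟨
          (k ∘ (Ff (l ∘₂ (Fg m ∘₂ Ar.hom≡ r₂ e₃)) ∘ hom≡ e₄)) ∘ hom≡ e₅ ∎)
        where
        open Category (ar.F₀ r₃)
        open ≡-Reasoning
        open Category (ar.F₀ r₂) using () renaming (_∘_ to _∘₂_)
        Ff : ∀ {x y} → Hom (ar.F₀ r₂) x y → Hom (ar.F₀ r₃) (reindex f x) (reindex f y)
        Ff = F₁ (ar.F₁ f)
        Fg : ∀ {x y} → Hom (ar.F₀ r₁) x y → Hom (ar.F₀ r₂) (reindex g x) (reindex g y)
        Fg = F₁ (ar.F₁ g)
        Ffg : ∀ {x y} → Hom (ar.F₀ r₁) x y →
              Hom (ar.F₀ r₃) (reindex (f R.∘ g) x) (reindex (f R.∘ g) y)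
        Ffg = F₁ (ar.F₁ (f R.∘ g))
        e₁ = at (ar.homomorphism f g) i₁
        e₂ = at (ar.homomorphism (f R.∘ g) h) i₀
        e₃ = at (ar.homomorphism g h) i₀
        e₄ = at (ar.homomorphism f (g R.∘ h)) i₀
        e₅ = cong (λ h → reindex h i₀) (R.assoc f g h)
        e₁′ = at (ar.homomorphism f g) (reindex h i₀)
        hom≡-collapse : hom≡ e₁′ ∘ hom≡ e₂ ≡ hom≡ (cong (reindex f) e₃) ∘ (hom≡ e₄ ∘ hom≡ e₅)
        hom≡-collapse = begin
          hom≡ e₁′ ∘ hom≡ e₂
            ≡⟨ hom≡-trans e₂ e₁′ ⟩
          hom≡ (trans e₂ e₁′)
            ≡⟨ hom≡-unique (trans e₂ e₁′) (trans (trans e₅ e₄) (cong (reindex f) e₃)) ⟩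
          hom≡ (trans (trans e₅ e₄) (cong (reindex f) e₃))
            ≡⟨ hom≡-trans (trans e₅ e₄) _ ⟨
          hom≡ (cong (reindex f) e₃) ∘ hom≡ (trans e₅ e₄)
            ≡⟨ cong (hom≡ (cong (reindex f) e₃) ∘_) (hom≡-trans e₅ e₄) ⟨
          hom≡ (cong (reindex f) e₃) ∘ (hom≡ e₄ ∘ hom≡ e₅) ∎
        expand : Ff (l ∘₂ (Fg m ∘₂ Ar.hom≡ r₂ e₃)) ≡ Ff l ∘ (Ff (Fg m) ∘ hom≡ (cong (reindex f) e₃))
        expand = trans (Functor.homomorphism (ar.F₁ f) l _)
                   (cong (Ff l ∘_)
                     (trans (Functor.homomorphism (ar.F₁ f) (Fg m) _)
                       (cong (Ff (Fg m) ∘_) (Functor.F₁-hom≡ (ar.F₁ f) e₃))))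
        inner : (Ff l ∘ hom≡ e₁) ∘ (Ffg m ∘ hom≡ e₂) ≡
                Ff (l ∘₂ (Fg m ∘₂ Ar.hom≡ r₂ e₃)) ∘ (hom≡ e₄ ∘ hom≡ e₅)
        inner = begin
          (Ff l ∘ hom≡ e₁) ∘ (Ffg m ∘ hom≡ e₂)
            ≡⟨ assoc _ _ _ ⟩
          Ff l ∘ (hom≡ e₁ ∘ (Ffg m ∘ hom≡ e₂))
            ≡⟨ cong (Ff l ∘_) (assoc _ _ _) ⟨
          Ff l ∘ ((hom≡ e₁ ∘ Ffg m) ∘ hom≡ e₂)
            ≡⟨ cong (λ x → Ff l ∘ (x ∘ hom≡ e₂)) (slide (ar.homomorphism f g) m) ⟩
          Ff l ∘ ((Ff (Fg m) ∘ hom≡ e₁′) ∘ hom≡ e₂)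
            ≡⟨ cong (Ff l ∘_) (assoc _ _ _) ⟩
          Ff l ∘ (Ff (Fg m) ∘ (hom≡ e₁′ ∘ hom≡ e₂))
            ≡⟨ cong (λ x → Ff l ∘ (Ff (Fg m) ∘ x)) hom≡-collapse ⟩
          Ff l ∘ (Ff (Fg m) ∘ (hom≡ (cong (reindex f) e₃) ∘ (hom≡ e₄ ∘ hom≡ e₅)))
            ≡⟨ cong (Ff l ∘_) (assoc _ _ _) ⟨
          Ff l ∘ ((Ff (Fg m) ∘ hom≡ (cong (reindex f) e₃)) ∘ (hom≡ e₄ ∘ hom≡ e₅))
            ≡⟨ assoc _ _ _ ⟨
          (Ff l ∘ (Ff (Fg m) ∘ hom≡ (cong (reindex f) e₃))) ∘ (hom≡ e₄ ∘ hom≡ e₅)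
            ≡⟨ cong (_∘ (hom≡ e₄ ∘ hom≡ e₅)) expand ⟨
          Ff (l ∘₂ (Fg m ∘₂ Ar.hom≡ r₂ e₃)) ∘ (hom≡ e₄ ∘ hom≡ e₅) ∎

    Groth : Category ℓ ℓ
    Groth = record
      { Obj = GObj
      ; Hom = GHom
      ; id = gid
      ; _∘_ = _∙_
      ; identityˡ = ∙-identityˡ
      ; identityʳ = ∙-identityʳ
      ; assoc = ∙-assoc
      }

    opfibration : Functor Groth R
    opfibration = record
      { F₀ = proj₁ ; F₁ = proj₁ ; identity = λ _ → refl ; homomorphism = λ _ _ → refl }

  record ProofSystem (Jdg : Category ℓ ℓ) : Set (suc ℓ) where
    field
      {R}              : Category ℓ ℓ
      ar               : Functor R Cat
      prem             : Functor (Groth ar) Jdg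
      ccl              : Functor R Jdg
      premise-twoSided : IsTwoSidedDiscreteFibration prem (opfibration ar)
      ccl-discrete     : IsDiscreteFibration ccl
      -- Lets a formula at one premise be read at the other.  It is a field because the
      -- previous ones determine ar(h)(i) only up to an isomorphism in the fibre, which
      -- prem may send to a non-identity.
      prem-reindex     : ∀ {r₁ r₂} (h : Hom R r₁ r₂) i →
                         F₀ prem (r₁ , i) ≡ F₀ prem (r₂ , reindex ar h i)

    Arity : Obj R → Set ℓ
    Arity r = Obj (F₀ ar r)

    conclusion : Obj R → Obj Jdg
    conclusion = F₀ ccl

    premise : ∀ r → Arity r → Obj Jdg
    premise r i = F₀ prem (r , i)

    polynomial : Polynomial Jdg
    polynomial = record
      { s = prem ; q = opfibration ar ; t = ccl
      ; sq-twoSided = premise-twoSided ; t-discrete = ccl-discrete }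

  module _ {Jdg : Category ℓ ℓ} (P : ProofSystem Jdg) where
    open ProofSystem P

    PreProof : Presheaf Jdg → Set ℓ
    PreProof = Coalgebra F[ polynomial ]

    module Graph {C : Presheaf Jdg} (c : PreProof C) where

      Node : Set ℓ
      Node = Σ (Obj Jdg) (F₀ C)

      rule : Node → Obj R
      rule (s , n) = proj₁ (proj₁ (η c s n))

      rule-ccl : ∀ x → conclusion (rule x) ≡ proj₁ x
      rule-ccl (s , n) = proj₂ (proj₁ (η c s n))

      -- n_i is the component at i, viewed as an object over (the identity of) r.
      child : ∀ x (i : Arity (rule x)) → F₀ C (premise (rule x) i)
      child (s , n) i = component (proj₂ (η c s n)) (_ , i) (Category.id R)

      Edge : ∀ x → Arity (rule x) → Node → Set ℓ
      Edge x i y = y ≡ (premise (rule x) i , child x i)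

      record InfinitePath : Set ℓ where
        field
          node  : ℕ → Node
          label : ∀ k → Arity (rule (node k))
          edge  : ∀ k → Edge (node k) (label k) (node (1+ k))

      suffix : ℕ → InfinitePath → InfinitePath
      suffix m π = record
        { node = λ k → node (k + m) ; label = λ k → label (k + m) ; edge = λ k → edge (k + m) }
        where open InfinitePath π

    record TraceStructure : Set (suc ℓ) where
      field
        fml   : Presheaf Jdg
        T     : ProofSystem (∫ fml)
        p-fml : PolynomialMorphism (projection fml) (ProofSystem.polynomial T) polynomial

      private
        module T = ProofSystem T
        module p = PolynomialMorphism p-fml
        module fml = Functor fml

      Step : ∀ r (i : Arity r) → fml.F₀ (conclusion r) → fml.F₀ (premise r i) → Set ℓ
      Step r i φ ψ = ∃[ i′ ]
        F₀ p.u₁ i′ ≡ (r , i) ×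
        F₀ T.prem i′ ≡ (premise r i , ψ) ×
        F₀ T.ccl (F₀ (opfibration T.ar) i′) ≡ (conclusion r , φ)

      pull : ∀ {r₁ r₂} (h : Hom R r₁ r₂) {i} →
             fml.F₀ (premise r₂ (reindex ar h i)) → fml.F₀ (premise r₁ i)
      pull h {i} = subst fml.F₀ (sym (prem-reindex h i))

      field
        Prog        : ∀ r (i : Arity r) → fml.F₀ (conclusion r) → fml.F₀ (premise r i) → Set ℓ
        prog⇒step   : ∀ {r i φ ψ} → Prog r i φ ψ → Step r i φ ψ
        step-closed : ∀ {r₁ r₂} (h : Hom R r₁ r₂) {i φ ψ} →
                      Step r₂ (reindex ar h i) φ ψ →
                      Step r₁ i (fml.F₁ (F₁ ccl h) φ) (pull h ψ)
        prog-closed : ∀ {r₁ r₂} (h : Hom R r₁ r₂) {i φ ψ} →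
                      Prog r₂ (reindex ar h i) φ ψ →
                      Prog r₁ i (fml.F₁ (F₁ ccl h) φ) (pull h ψ)

    module _ {C : Presheaf Jdg} (c : PreProof C) (𝒯 : TraceStructure) where
      open Graph c
      open TraceStructure 𝒯

      module _ (π : InfinitePath) where
        open InfinitePath π

        -- The formulas φ_k and φ_{k+1}, moved along ccl(r_k) = s_k and
        -- s_{k+1} = prem(r_k , j_k).
        Along : (∀ r (i : Arity r) → F₀ fml (conclusion r) → F₀ fml (premise r i) → Set ℓ) →
                (∀ k → F₀ fml (proj₁ (node k))) → ℕ → Set ℓ
        Along S φ k = S (rule (node k)) (label k)
                        (subst (F₀ fml) (sym (rule-ccl (node k))) (φ k))
                        (subst (F₀ fml) (cong proj₁ (edge k)) (φ (1+ k)))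

        record Trace : Set ℓ where
          field
            formula : ∀ k → F₀ fml (proj₁ (node k))
            steps   : ∀ k → Along Step formula k

        InfinitelyProgressing : Trace → Set ℓ
        InfinitelyProgressing τ = ∀ N → ∃[ k ] N ≤ k × Along Prog (Trace.formula τ) k

      GTC : Set ℓ
      GTC = ∀ π → ∃[ m ] Σ[ τ ∈ Trace (suffix m π) ] InfinitelyProgressing (suffix m π) τ

{-# OPTIONS --safe #-}
-- Let y ≺ x when y is a component of the family c(x).  On an accessible coalgebra the
-- equation h = a ∘ F[P](h) ∘ c is solved by recursion along ≺.  Conversely, for an
-- algebra on a cofree presheaf of truth values, the solutions of the equation are the
-- predicates that hold at x iff they hold at every y ≺ x; truth and accessibility are two
-- such predicates, so they agree when c is recursive.  Finally, q-lifts turn a component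
-- into an edge of the labelled graph, so accessibility excludes infinite paths and, by
-- choice, conversely.  Without infinite paths the GTC is vacuous; on the trace structure
-- without formulas it says that there are none.
module Submission where

open import Axiom.ExcludedMiddle using (ExcludedMiddle)
open import Axiom.Extensionality.Propositional
  using (Extensionality; implicit-extensionality; lower-extensionality)
open import Data.Bool.Base using (Bool; true)
open import Data.Empty.Polymorphic using (⊥)
open import Data.Nat.Base using (ℕ) renaming (zero to 0#; suc to 1+_)
open import Data.Product using (∃!; Σ-syntax; ∃-syntax; _,_; proj₁; proj₂)
open import Function.Base using (_∘_)
open import Function.Bundles using (Equivalence; _⇔_; mk⇔)
open import Function.Construct.Composition using (_⇔-∘_)
open import Induction.WellFounded using (Acc; acc; WellFounded)
open import Level using (0ℓ; lower)
open import Relation.Binary.PropositionalEquality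
  using (_≡_; refl; sym; trans; cong; cong-app; subst)
open import Relation.Nullary using (¬_; Dec; yes; no; does; contradiction)
open import Relation.Nullary.Decidable using (decidable-stable; dec-true; does-⇔)
open import Defs

module _ {ℓ} {fe : Extensionality ℓ ℓ} where
  open Extensional fe

  -- The component relation of a coalgebra of a familial functor.

  module _ {𝔸 : Category ℓ ℓ} (Q : Polynomial 𝔸) {C : Presheaf 𝔸}
           (c : Coalgebra F[ Q ] C) where
    private
      module 𝔸 = Category 𝔸
      module C = Functor C
    open Polynomial Q

    private
      module q = Functor q

    Element : Set ℓ
    Element = Σ[ a ∈ 𝔸.Obj ] C.F₀ a

    shape : ((a , n) : Element) → Obj 𝕁
    shape (a , n) = proj₁ (proj₁ (η c a n))

    arguments : ((a , n) : Element) → Family q (C ∘F opF s) (shape (a , n))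
    arguments (a , n) = proj₂ (η c a n)

    argument : ∀ x i → Hom 𝕁 (q.F₀ i) (shape x) → Element
    argument x i v = F₀ s i , component (arguments x) i v

    infix 4 _≺_

    -- Components over the whole comma category count, not only those in the fibre, so that the
    -- relation matches `Family` directly.
    _≺_ : Element → Element → Set ℓ
    y ≺ x = ∃[ i ] Σ[ v ∈ Hom 𝕁 (q.F₀ i) (shape x) ] y ≡ argument x i v

    -- Well-founded coalgebras are recursive.

    module _ {A : Presheaf 𝔸} (alg : Algebra F[ Q ] A) where

      IsHylo : NatTrans C A → Set ℓ
      IsHylo h = h ≡ Category._∘_ (Psh 𝔸) alg (Category._∘_ (Psh 𝔸) (F₁ F[ Q ] h) c)

      pointwise⇒isHylo : ∀ h →
        (∀ a n → η h a n ≡ η alg a (η (F₁ F[ Q ] h) a (η c a n))) → IsHylo h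
      pointwise⇒isHylo h eq = natTrans-≡ λ a → fe (eq a)

      isHylo⇒pointwise : ∀ h → IsHylo h →
        ∀ a n → η h a n ≡ η alg a (η (F₁ F[ Q ] h) a (η c a n))
      isHylo⇒pointwise h e a n = cong (λ k → η k a n) e

      -- The graph of the sought h. Recursion on values alone gets stuck: a `Family` of values must
      -- be compatible, which rests on naturality of h. As a relation, h is shown functional and
      -- stable under restriction before any value is built.
      data Solution {a} (n : C.F₀ a) : F₀ A a → Set ℓ

      data Related {a} : F₀ (F₀ F[ Q ] C) a → F₀ (F₀ F[ Q ] A) a → Set ℓ where
        related : ∀ {j x y} →
                  (∀ i v → Solution (component x i v) (component y i v)) →
                  Related (j , x) (j , y)

      data Solution {a} n where
        solution : ∀ {y} → Related (η c a n) y → Solution n (η alg a y)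

      solution-functional : ∀ {a} {n : C.F₀ a} {x y} →
                            Solution n x → Solution n y → x ≡ y
      related-functional : ∀ {a} {m : F₀ (F₀ F[ Q ] C) a} {x y} →
                           Related m x → Related m y → x ≡ y

      solution-functional {a} (solution p) (solution p′) =
        cong (η alg a) (related-functional p p′)

      related-functional (related p) (related p′) =
        cong (_ ,_) (family-≡ q λ i v → solution-functional (p i v) (p′ i v))

      -- With g the lift of f, the component of a restricted family at v is the old one at g ∘ v, so
      -- the given derivations are reused.
      related-restrict : ∀ {a b} (f : 𝔸.Hom b a) {m y} → Related m y →
        Related (F₁ (F₀ F[ Q ] C) f m) (F₁ (F₀ F[ Q ] A) f y)
      related-restrict {b = b} f (related {j = j , refl} p) with t-discrete j (b , f)
      ... | (_ , g) , _ = related λ i v → p i (Category._∘_ 𝕁 g v)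

      solution-restrict : ∀ {a b} (f : 𝔸.Hom b a) {n x} →
                          Solution n x → Solution (C.F₁ f n) (F₁ A f x)
      solution-restrict {b = b} f {n} (solution {y} p) =
        subst (Solution (C.F₁ f n)) (sym (cong-app (NatTrans.natural alg f) y))
          (solution (subst (λ m → Related m (F₁ (F₀ F[ Q ] A) f y))
                      (cong-app (NatTrans.natural c f) n) (related-restrict f p)))

      solution-exists : ∀ {a n} → Acc _≺_ (a , n) → ∃[ x ] Solution n x
      solution-exists {a} {n} (acc rs) =
        η alg a (_ , y) , solution (related λ i v → proj₂ (ih i v))
        where
        ih : ∀ i v → ∃[ x ] Solution (component (arguments (a , n)) i v) x
        ih i v = solution-exists (rs (i , v , refl))
        y : Family q (A ∘F opF s) (shape (a , n))
        -- By compatibility of `arguments`, the solution at v restricted along w solves the same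
        -- component as the solution at v ∘ q(w); functionality identifies the two.
        y = family (λ i v → proj₁ (ih i v)) λ w v →
          solution-functional
            (subst (λ m → Solution m (F₁ A (F₁ s w) (proj₁ (ih _ v))))
              (compatible (arguments (a , n)) w v)
              (solution-restrict (F₁ s w) (proj₂ (ih _ v))))
            (proj₂ (ih _ _))

      uniqueHylo : ∀ h → IsHylo h → (∀ {k} → IsHylo k → h ≡ k) →
                   ∃! _≡_ λ (k : NatTrans C A) →
                     k ≡ Category._∘_ (Psh 𝔸) alg (Category._∘_ (Psh 𝔸) (F₁ F[ Q ] k) c)
      uniqueHylo h e u = h , e , u

      -- Induction on the derivation: each layer unfolds the equation for k once.
      solution-unique : ∀ {k} → IsHylo k → ∀ {a} {n : C.F₀ a} {x} →
                        Solution n x → x ≡ η k a n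
      related-unique : ∀ {k} → IsHylo k → ∀ {a} {m : F₀ (F₀ F[ Q ] C) a} {y} →
                       Related m y → y ≡ η (F₁ F[ Q ] k) a m

      solution-unique {k} e {a} {n} (solution p) =
        trans (cong (η alg a) (related-unique e p)) (sym (isHylo⇒pointwise k e a n))

      related-unique e (related p) =
        cong (_ ,_) (family-≡ q λ i v → solution-unique e (p i v))

      module _ (wf : WellFounded _≺_) where

        solve : ∀ {a} (n : C.F₀ a) → ∃[ x ] Solution n x
        solve {a} n = solution-exists (wf (a , n))

        hylo : NatTrans C A
        hylo = record
          { η = λ a n → proj₁ (solve n)
          ; natural = λ f → fe λ n → solution-functional
              (solution-restrict f (proj₂ (solve n))) (proj₂ (solve (C.F₁ f n))) }

        hylo-isHylo : IsHylo hylo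
        hylo-isHylo = pointwise⇒isHylo hylo λ a n → solution-functional (proj₂ (solve n))
          (solution (related λ i v → proj₂ (solve (component (arguments (a , n)) i v))))

        hylo-unique : ∀ {k} → IsHylo k → hylo ≡ k
        hylo-unique e = natTrans-≡ λ a → fe λ n → solution-unique e (proj₂ (solve n))

    wellFounded⇒recursive : WellFounded _≺_ → Recursive F[ Q ] c
    wellFounded⇒recursive wf {A} alg = uniqueHylo {A} alg
      (hylo {A} alg wf) (hylo-isHylo {A} alg wf) (hylo-unique {A} alg wf)

    -- Recursive coalgebras are well-founded.

    private
      fe₀ : Extensionality ℓ 0ℓ
      fe₀ = lower-extensionality 0ℓ ℓ fe

    -- An element records one truth value for every restriction. Taking `Bool` rather than `Set ℓ`
    -- keeps the presheaf at level ℓ.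
    cofree : Presheaf 𝔸
    cofree = record
      { F₀ = λ a → ∀ b → 𝔸.Hom b a → Bool
      ; F₁ = λ f x b g → x b (f 𝔸.∘ g)
      ; identity = λ a → fe λ x → fe λ b → fe₀ λ g → cong (x b) (𝔸.identityˡ g)
      ; homomorphism = λ g f → fe λ x → fe λ b → fe₀ λ k → cong (x b) (𝔸.assoc f g k)
      }

    -- Recording p at all restrictions is natural by construction, so p may be any predicate, stable
    -- under restriction or not.
    transpose : ∀ {X : Presheaf 𝔸} → (∀ {a} → F₀ X a → Bool) → NatTrans X cofree
    transpose {X} p = record
      { η = λ a x b g → p (F₁ X g x)
      ; natural = λ f → fe λ x → fe λ b → fe₀ λ g →
          cong p (cong-app (Functor.homomorphism X g f) x)
      }

    -- Evaluation at the identity is the counit: it returns the truth value of the component itself.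
    AllTrue : ∀ {a} → F₀ (F₀ F[ Q ] cofree) a → Set ℓ
    AllTrue (_ , y) = ∀ i v → component y i v (F₀ s i) 𝔸.id ≡ true

    module _ (em : ExcludedMiddle ℓ) where

      allTrue : Algebra F[ Q ] cofree
      allTrue = transpose λ y → does (em {AllTrue y})

      recursive⇒wellFounded : Recursive F[ Q ] c → WellFounded _≺_
      recursive⇒wellFounded rec (a , n) = accessible
        where
        accessible? : ∀ {a} → C.F₀ a → Bool
        accessible? {a} n = does (em {Acc _≺_ (a , n)})

        -- The value at a restriction g is the hypothesis at the restricted element, moved back by
        -- naturality.
        transpose-solves : ∀ (p : ∀ {a} → C.F₀ a → Bool) →
          (∀ {a} (n : C.F₀ a) →
            p n ≡ does (em {AllTrue (η (F₁ F[ Q ] (transpose {C} p)) a (η c a n))})) →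
          IsHylo {cofree} allTrue (transpose p)
        transpose-solves p eq = pointwise⇒isHylo {cofree} allTrue (transpose p)
          λ a n → fe λ b → fe₀ λ g →
          trans (eq (C.F₁ g n))
            (sym (cong (λ y → does (em {AllTrue y}))
              (cong-app (NatTrans.natural
                (Category._∘_ (Psh 𝔸) (F₁ F[ Q ] (transpose {C} p)) c) g) n)))

        does-true : ∀ {X : Set ℓ} (d : Dec X) → does d ≡ true → X
        does-true (yes x) _ = x

        C-id : ∀ {a} (n : C.F₀ a) → C.F₁ 𝔸.id n ≡ n
        C-id {a} = cong-app (C.identity a)

        true-solves = transpose-solves (λ _ → true) λ n → sym (dec-true em λ i v → refl)

        -- `AllTrue` sees each component restricted along the identity; `C-id` removes this
        -- restriction.
        accessible-solves = transpose-solves accessible? λ {a} n → does-⇔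
          (mk⇔ (λ { (acc rs) i v → dec-true em
                     (subst (λ m → Acc _≺_ (F₀ s i , m)) (sym (C-id _)) (rs (i , v , refl))) })
               (λ all → acc λ { (i , v , refl) →
                     subst (λ m → Acc _≺_ (F₀ s i , m)) (C-id _) (does-true em (all i v)) }))
          em em

        unique = proj₂ (proj₂ (rec {cofree} allTrue))

        accessible : Acc _≺_ (a , n)
        -- Uniqueness equates the two solutions; they are compared at n and the identity.
        accessible = subst (λ m → Acc _≺_ (a , m)) (C-id n)
          (does-true em (cong (λ h → η h a n a 𝔸.id)
            (trans (sym (unique accessible-solves)) (unique true-solves))))

      recursive⇔wellFounded : Recursive F[ Q ] c ⇔ WellFounded _≺_
      recursive⇔wellFounded = mk⇔ recursive⇒wellFounded wellFounded⇒recursive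

  -- Accessibility and infinite paths in the labelled graph.

  module _ {Jdg : Category ℓ ℓ} (P : ProofSystem Jdg) where
    open ProofSystem P hiding (polynomial)
    open ProofSystem using (polynomial)

    module _ {C : Presheaf Jdg} (c : PreProof P C) where
      open Graph P c

      private
        infix 4 _≺ᶜ_
        _≺ᶜ_ = _≺_ {Jdg} (polynomial P) {C} c

      edge⇒≺ : ∀ {x y} i → Edge x i y → y ≺ᶜ x
      edge⇒≺ i e = (_ , i) , Category.id R , e

      -- The q-lift g of v ends in the fibre over `rule x`, at some j. Compatibility along g makes
      -- the component at v the restriction of `child x j` along prem(g), which is an identity.
      ≺⇒edge : ∀ {x y} → y ≺ᶜ x → ∃[ i ] Edge x i y
      ≺⇒edge {x} (i , v , refl)
        with IsTwoSidedDiscreteFibration.q-lift premise-twoSided i (rule x , v)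
      ... | ((_ , j) , g) , (refl , fixed) , _ = j , go fixed comp
        where
        comp : F₁ C (F₁ prem g) (child x j) ≡
               component (arguments {Jdg} (polynomial P) {C} c x) i v
        comp = trans
          (compatible (arguments {Jdg} (polynomial P) {C} c x) g (Category.id R))
          (cong (component (arguments {Jdg} (polynomial P) {C} c x) i)
                (Category.identityˡ R _))

        go : ∀ {a b} {f : Hom Jdg a b} {n : F₀ C b} {m : F₀ C a} →
             _≡_ {A = OutOf Jdg a} (b , f) (a , Category.id Jdg) → F₁ C f n ≡ m →
             _≡_ {A = Node} (a , m) (b , n)
        go {a} {n = n} refl refl = cong (a ,_) (cong-app (Functor.identity C a) n)

      wellFounded⇒no-path : WellFounded _≺ᶜ_ → ¬ InfinitePath
      wellFounded⇒no-path wf π = go 0# (wf (node 0#))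
        where
        open InfinitePath π
        go : ∀ k → ¬ Acc _≺ᶜ_ (node k)
        go k (acc rs) = go (1+ k) (rs (edge⇒≺ (label k) (edge k)))

      no-path⇒wellFounded : ExcludedMiddle ℓ → ¬ InfinitePath → WellFounded _≺ᶜ_
      no-path⇒wellFounded em none x = decidable-stable em λ ¬acc → none (path (x , ¬acc))
        where
        Bad : Set ℓ
        Bad = Σ[ x ∈ Node ] ¬ Acc _≺ᶜ_ x

        bad-child : ((x , _) : Bad) → Σ[ (y , _) ∈ Bad ] ∃[ i ] Edge x i y
        bad-child (x , ¬acc)
          -- Deciding the Σ-type itself yields a chosen witness, so a path arises by plain
          -- iteration.
          with em {Σ[ (y , _) ∈ Bad ] ∃[ i ] Edge x i y}
        ... | yes found = found
        ... | no none = contradiction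
          (acc λ y≺x → decidable-stable em λ ¬acc-y → none ((_ , ¬acc-y) , ≺⇒edge y≺x)) ¬acc

        path : Bad → InfinitePath
        path b = record
          { node = proj₁ ∘ bad
          ; label = proj₁ ∘ proj₂ ∘ bad-child ∘ bad
          ; edge = proj₂ ∘ proj₂ ∘ bad-child ∘ bad
          }
          where
          bad : ℕ → Bad
          bad 0# = b
          bad (1+ k) = proj₁ (bad-child (bad k))

    -- The trace structure without formulas.

    private
      ∅ : Category ℓ ℓ
      ∅ = record
        { Obj = ⊥ ; Hom = λ () ; id = λ { {()} } ; _∘_ = λ { {()} }
        ; identityˡ = λ { {()} } ; identityʳ = λ { {()} } ; assoc = λ { {()} } }

      fromEmpty : ∀ {o h} {D : Category o h} {E : Category ℓ ℓ} → ¬ Obj E → Functor E D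
      fromEmpty empty = record
        { F₀ = λ x → contradiction x empty
        ; F₁ = λ {x} _ → contradiction x empty
        ; identity = λ x → contradiction x empty
        ; homomorphism = λ {x} _ _ → contradiction x empty
        }

      fromEmpty-unique : ∀ {D E : Category ℓ ℓ} → ¬ Obj E →
                         (F G : Functor E D) → F ≡ G
      fromEmpty-unique {D} {E} empty F G =
        functor-≡ (go (fe λ x → contradiction x empty))
        where
        go : ∀ {f₀ g₀ : Obj E → Obj D}
               {f₁ : ∀ {x y} → Hom E x y → Hom D (f₀ x) (f₀ y)}
               {g₁ : ∀ {x y} → Hom E x y → Hom D (g₀ x) (g₀ y)} →
             f₀ ≡ g₀ →
             _≡_ {A = Σ[ f₀ ∈ (Obj E → Obj D) ] (∀ {x y} → Hom E x y → Hom D (f₀ x) (f₀ y))}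
                 (f₀ , f₁) (g₀ , g₁)
        go refl = cong (_ ,_) (implicit-extensionality fe λ {x} → contradiction x empty)

    formulaFree : TraceStructure P
    formulaFree = record
      { fml = fml
      ; T = T
      ; p-fml = record
          { u₁ = fromEmpty (λ ())
          ; u₂ = fromEmpty (λ ())
          ; s-square = fromEmpty-unique (λ ()) _ _
          ; q-square = fromEmpty-unique (λ ()) _ _
          ; t-square = record
              { commutes = fromEmpty-unique (λ ()) _ _
              -- A category with a functor to the empty `∫ fml` has no objects itself, so functors
              -- out of it exist and are unique.
              ; universal = λ q₁ q₂ _ → let empty = λ x → lower (proj₂ (F₀ q₁ x)) in
                  fromEmpty empty ,
                  (fromEmpty-unique empty _ _ , fromEmpty-unique empty _ _) ,
                  λ _ → fromEmpty-unique empty _ _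
              }
          }
      ; Prog = λ _ _ ()
      ; prog⇒step = λ { {φ = ()} }
      ; step-closed = λ { _ {φ = ()} }
      ; prog-closed = λ { _ {φ = ()} }
      }
      where
      fml : Presheaf Jdg
      fml = record
        { F₀ = λ _ → ⊥ ; F₁ = λ _ x → x
        ; identity = λ _ → refl ; homomorphism = λ _ _ → refl }

      T : ProofSystem (∫ fml)
      T = record
        { R = ∅
        ; ar = fromEmpty (λ ())
        ; prem = fromEmpty (λ ())
        ; ccl = fromEmpty (λ ())
        ; premise-twoSided = record
            { s-lift = λ () ; q-lift = λ () ; factorisation = λ { {()} } }
        ; ccl-discrete = λ ()
        ; prem-reindex = λ { {()} }
        }

    -- A trace along any suffix has a formula at its first node, and here there is none.
    gtc⇒no-path : ∀ {C : Presheaf Jdg} (c : PreProof P C) →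
                  GTC P c formulaFree → ¬ Graph.InfinitePath P c
    gtc⇒no-path c gtc π with gtc π
    ... | _ , τ , _ with Trace.formula τ 0#
    ... | ()

    -- Combining the equivalences.

    wellFounded⇔gtc : ExcludedMiddle ℓ → ∀ {C : Presheaf Jdg} (c : PreProof P C) →
      WellFounded (_≺_ {Jdg} (polynomial P) {C} c) ⇔
      (∀ (𝒯 : TraceStructure P) → GTC P c 𝒯)
    wellFounded⇔gtc em {C} c = mk⇔
      (λ wf 𝒯 π → contradiction π (wellFounded⇒no-path {C} c wf))
      (λ gtc → no-path⇒wellFounded {C} c em (gtc⇒no-path {C} c (gtc formulaFree)))

    -- Reaching polynomial P by matching on an equation keeps Agda from comparing two
    -- elaborations of F[ polynomial P ] field by field, which takes minutes.
    recursive-transfer : ∀ {C : Presheaf Jdg}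
      (W : ∀ Q → Coalgebra (F[_] {Jdg} Q) C → Set ℓ) Q → Q ≡ polynomial P →
      (∀ c → Recursive (F[_] {Jdg} Q) {C} c ⇔ W Q c) →
      ∀ {b} {B : Set b} (c : PreProof P C) →
      W (polynomial P) c ⇔ B → Recursive F[ polynomial P ] c ⇔ B
    recursive-transfer W Q refl equiv c g = g ⇔-∘ equiv c

    recursive⇔gtc : ExcludedMiddle ℓ → ∀ Q → Q ≡ polynomial P →
      ∀ {C : Presheaf Jdg} (c : PreProof P C) →
      Recursive F[ polynomial P ] c ⇔ (∀ (𝒯 : TraceStructure P) → GTC P c 𝒯)
    recursive⇔gtc em Q e {C} c =
      recursive-transfer (λ Q c → WellFounded (_≺_ {Jdg} Q {C} c)) Q e
        (λ c → recursive⇔wellFounded {Jdg} Q {C} c em) c (wellFounded⇔gtc em {C} c)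

    recursive⇒gtc : ExcludedMiddle ℓ → ∀ Q → Q ≡ polynomial P →
      ∀ {C : Presheaf Jdg} (c : PreProof P C) →
      Recursive F[ polynomial P ] c → ∀ (𝒯 : TraceStructure P) → GTC P c 𝒯
    recursive⇒gtc em Q e c = Equivalence.to (recursive⇔gtc em Q e c)

    gtc⇒recursive : ExcludedMiddle ℓ → ∀ Q → Q ≡ polynomial P →
      ∀ {C : Presheaf Jdg} (c : PreProof P C) →
      (∀ (𝒯 : TraceStructure P) → GTC P c 𝒯) → Recursive F[ polynomial P ] c
    gtc⇒recursive em Q e c = Equivalence.from (recursive⇔gtc em Q e c)

proposition4p14 : ∀ {ℓ} → ExcludedMiddle ℓ → (fe : Extensionality ℓ ℓ) →
    let open Extensional fe in
    {Jdg : Category ℓ ℓ} (P : ProofSystem Jdg) {C : Presheaf Jdg} (c : PreProof P C) →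
    Recursive F[ ProofSystem.polynomial P ] c ⇔ (∀ (𝒯 : TraceStructure P) → GTC P c 𝒯)
-- Giving the fields separately makes Agda compare the two elaborations of Recursive only
-- once per direction.
proposition4p14 em fe {Jdg} P {C} c = record
  { to = recursive⇒gtc {Jdg = Jdg} P em _ refl {C} c
  ; from = gtc⇒recursive {Jdg = Jdg} P em _ refl {C} c
  ; to-cong = λ { refl → refl }
  ; from-cong = λ { refl → refl }
  }
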